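{- Let $Q=T[H_1,\dots,H_t]$ be a strong semicomplete composition of order $n$. For every $k\in\{1,\dots,n\}$ and $i\in\{1,\dots,t\}$, there exists an integer $n_{i,k}$ such that every maximum $k$-path subdigraph $\mathcal{F}$ of $Q$ satisfies $|V(H_i)\cap V(\mathcal{F})|=n_{i,k}$ and no $k$-path subdigraph of $Q$ contains more than $n_{i,k}$ vertices of $H_i$.
   Context: Digraphs are finite, without loops or parallel arcs (2-cycles are allowed); paths are directed, and a single vertex is a path. A digraph is semicomplete if there is at least one arc between every pair of distinct vertices. Let $T$ be a digraph with vertices $u_1,\dots,u_t$ ($t\ge 2$) and let $H_1,\dots,H_t$ be pairwise disjoint nonempty digraphs. The composition $Q=T[H_1,\dots,H_t]$ is the digraph with vertex set $\bigcup_i V(H_i)$ and arc set $\bigcup_{i=1}^t A(H_i)\cup\{xy : x\in V(H_i),\ y\in V(H_p),\ u_iu_p\in A(T)\}$. It is a semicomplete composition if $T$ is semicomplete. A digraph is strong if for every ordered pair of vertices $(x,y)$ there is a directed path from $x$ to $y$. A $k$-path subdigraph of a digraph $D$ is a collection of $k$ pairwise vertex-disjoint paths of $D$; $V(\mathcal{F})$ is the set of vertices covered by the paths in $\mathcal{F}$. A maximum $k$-path subdigraph is a $k$-path subdigraph covering the maximum number of vertices among all $k$-path subdigraphs of $D$. -}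

module Defs where

open import Data.Fin.Base using (Fin)
open import Data.Fin.Properties using (_≟_)
open import Data.List.Base using (List; []; length; map; concat; filter; head; last; tabulate)
open import Data.List.Relation.Binary.Disjoint.Propositional using (Disjoint)
open import Data.List.Relation.Unary.All using (universal)
import Data.List.Relation.Unary.All.Properties as All
open import Data.List.Relation.Unary.AllPairs using (AllPairs)
open import Data.List.Relation.Unary.Linked using (Linked)
open import Data.List.Relation.Unary.Unique.Propositional using (Unique)
import Data.List.Relation.Unary.Unique.Propositional.Properties as Unique
open import Data.Maybe.Base using (just)
open import Data.Nat.Base using (ℕ; _≤_)
open import Data.Nat.ListAction using (sum)
open import Data.Product.Base using (Σ; _×_; _,_; proj₁; ∃-syntax)
open import Data.Sum.Base using (_⊎_)
open import Relation.Binary.PropositionalEquality using (_≡_; _≢_; refl)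
open import Relation.Nullary using (¬_; Dec; yes; no)

-- Finiteness is imposed where digraphs are used, by taking V to be Fin n or a
-- finite sum of such types. The arc set of a finite digraph is decidable.
record Digraph (V : Set) : Set₁ where
  field
    Arc    : V → V → Set
    arc?   : ∀ x y → Dec (Arc x y)
    noLoop : ∀ x → ¬ Arc x x

open Digraph public

Semicomplete : {V : Set} → Digraph V → Set
Semicomplete D = ∀ x y → x ≢ y → Arc D x y ⊎ Arc D y x

record Path {V : Set} (D : Digraph V) : Set where
  field
    vertices : List V
    nonempty : vertices ≢ []
    distinct : Unique vertices
    linked   : Linked (Arc D) vertices

open Path public

Strong : {V : Set} → Digraph V → Set
Strong D = ∀ x y → ∃[ P ] (head (vertices {D = D} P) ≡ just x × last (vertices P) ≡ just y)

record PathSubdigraph {V : Set} (D : Digraph V) (k : ℕ) : Set where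
  field
    paths    : List (Path D)
    count    : length paths ≡ k
    disjoint : AllPairs Disjoint (map vertices paths)

open PathSubdigraph public

module _ {V : Set} {D : Digraph V} {k : ℕ} where

  -- V(F), listed without repetitions (see covered-unique), so that lengths of
  -- this list and of its sublists are cardinalities.
  covered : PathSubdigraph D k → List V
  covered F = concat (map vertices (paths F))

  covered-unique : (F : PathSubdigraph D k) → Unique (covered F)
  covered-unique F = Unique.concat⁺ (All.map⁺ (universal distinct (paths F))) (disjoint F)

  IsMaximum : PathSubdigraph D k → Set
  IsMaximum F = (G : PathSubdigraph D k) → length (covered G) ≤ length (covered F)

module _ {t : ℕ} (m : Fin t → ℕ) where

  -- The disjoint union of the vertex sets: (i , x) is the vertex x of H i.
  Vertex : Set
  Vertex = Σ (Fin t) (λ i → Fin (m i))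

  order : ℕ
  order = sum (tabulate m)

module _ {t : ℕ} {m : Fin t → ℕ} where

  data CompositionArc (T : Digraph (Fin t)) (H : (i : Fin t) → Digraph (Fin (m i))) :
                      Vertex m → Vertex m → Set where
    inside  : ∀ {i x y} → Arc (H i) x y → CompositionArc T H (i , x) (i , y)
    between : ∀ {i p x y} → Arc T i p → CompositionArc T H (i , x) (p , y)

  _[_] : Digraph (Fin t) → ((i : Fin t) → Digraph (Fin (m i))) → Digraph (Vertex m)
  T [ H ] = record { Arc = CompositionArc T H ; arc? = dec ; noLoop = irr }
    where
    dec : ∀ u v → Dec (CompositionArc T H u v)
    dec (i , x) (p , y) with arc? T i p
    ... | yes a = yes (between a)
    ... | no ¬a with i ≟ p
    ...   | no i≢p = no λ { (inside _) → i≢p refl ; (between a) → ¬a a }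
    ...   | yes refl with arc? (H i) x y
    ...     | yes b = yes (inside b)
    ...     | no ¬b = no λ { (inside b) → ¬b b ; (between a) → ¬a a }

    irr : ∀ u → ¬ CompositionArc T H u u
    irr (i , x) (inside b)  = noLoop (H i) x b
    irr (i , x) (between a) = noLoop T i a

  -- |V(H i) ∩ V(F)|
  coveredIn : {D : Digraph (Vertex m)} {k : ℕ} → Fin t → PathSubdigraph D k → ℕ
  coveredIn i F = length (filter (λ v → proj₁ v ≟ i) (covered F))

{-# OPTIONS --safe #-}

-- Add to T an apex joined in both directions to every vertex. Cutting each path of a k-path subdigraph
-- F of Q into its parts inside the H i turns F into a closed walk at the apex that visits it k times and
-- visits i once for each part of F in H i. If some k-path subdigraph has more parts in H i than F,
-- a flow augmentation in the semicomplete digraph T + apex raises the number of visits to i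
-- without lowering any other; the resulting circulation is a closed walk again, because a cycle can always
-- be spliced into a closed walk through the apex. As p disjoint paths of H j can be replaced by p + 1 paths
-- covering no fewer vertices (when p < |H j|), covering fewer vertices of H i than some other k-path
-- subdigraph contradicts maximality.

module Submission where

open import Defs
open import Data.Empty using (⊥)
open import Data.Unit.Base using (⊤; tt)
open import Data.Fin.Base using (Fin; zero; suc)
open import Data.Fin.Properties using (_≟_)
open import Data.List.Base using (List; []; _∷_; _++_; length; map; filter; concat; allFin; drop; replicate; cartesianProductWith)
open import Data.List.Extrema.Nat using (max; max≤v⁺; xs≤max)
open import Data.List.Properties using (length-replicate; filter-some; filter-all; filter-none; filter-++; ++-assoc; length-map; length-tabulate; length-++)
open import Data.List.Membership.Propositional using (_∈_; _∉_; find)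
open import Data.List.Membership.Propositional.Properties using (∈-∃++; ∈-filter⁻; ∈-map⁻; ∈-map⁺; ∈-++⁺ˡ; ∈-++⁺ʳ; ∈-allFin; ∈-filter⁺; ∈-concat⁺′; ∈-cartesianProductWith⁺)
open import Data.List.Relation.Binary.Permutation.Propositional using (_↭_; module PermutationReasoning; refl; prep; swap; ↭-sym; ↭-trans)
import Data.List.Relation.Binary.Permutation.Propositional.Properties as Perm
open import Data.List.Relation.Unary.All using (All; []; _∷_)
import Data.List.Relation.Unary.All as All
open import Data.List.Relation.Unary.Any using (any?; here; there)
import Data.List.Relation.Unary.Any as Any
open import Data.List.Relation.Unary.AllPairs using (AllPairs; []; _∷_)
open import Data.List.Relation.Unary.Linked using (Linked; []; [-]; _∷_; linked?)
open import Data.List.Relation.Unary.Unique.Propositional using (Unique)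
import Data.List.Relation.Unary.Unique.Propositional.Properties as Unique
open import Data.List.Relation.Binary.Disjoint.Propositional using (Disjoint)
import Data.List.Relation.Unary.All.Properties as AllP
open import Data.Nat.Base using (ℕ; zero; suc; _+_; _∸_; _≤_; _<_; z≤n; s≤s; NonZero)
open import Data.Nat.Properties using (module ≤-Reasoning; ≤-antisym; m≤m+n; m≤n+m; m∸n+n≡m; ≤-refl; ≤-trans; ≤-reflexive; ≤-pred; n≤1+n; m≤n⇒m≤1+n; +-suc; +-monoʳ-≤; +-cancelʳ-≤; <-irrefl; <-≤-trans; ≮⇒≥; _<?_; suc-injective) renaming (_≟_ to _≟ᴺᵃᵗ_)
open import Data.Product.Base using (_×_; _,_; proj₁; proj₂; ∃-syntax; Σ-syntax)
open import Data.Product.Properties using (≡-dec)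
open import Data.Sum.Base using (_⊎_; inj₁; inj₂)
open import Function.Base using (_∘_; id)
open import Relation.Binary.Core using (Rel)
open import Relation.Binary.Definitions using (DecidableEquality)
import Relation.Binary.Definitions as B
open import Relation.Binary.PropositionalEquality using (_≡_; _≢_; refl; sym; trans; cong; subst)
open import Relation.Nullary using (¬_; yes; no; contradiction; ¬?; _×-dec_; _⊎-dec_)
open import Relation.Nullary.Decidable using (map′; decidable-stable)
open import Relation.Unary using (Pred; Decidable)
open import Level using (0ℓ)

-- Counting in lists: filtered lengths and multiplicities.

extract : {A : Set} {x : A} {xs : List A} → x ∈ xs → ∃[ ys ] xs ↭ x ∷ ys
extract {x = x} x∈xs with ys , zs , refl ← ∈-∃++ x∈xs = ys ++ zs , Perm.shift x ys zs

module _ {A B : Set} {P : Pred B 0ℓ} {Q : Pred B 0ℓ} (P? : Decidable P) (Q? : Decidable Q) (f g : A → B) where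

  -- Used with the two projections of arcs as `f` and `g`: it then compares the tails on one side of
  -- a cut with the heads on the other.
  length-filter-mono : ∀ {xs} → All (λ x → P (f x) → Q (g x)) xs →
                       length (filter P? (map f xs)) ≤ length (filter Q? (map g xs))
  length-filter-mono [] = z≤n
  length-filter-mono {x ∷ _} (p⇒q ∷ ps) with P? (f x) | Q? (g x)
  ... | yes p | yes _  = s≤s (length-filter-mono ps)
  ... | yes p | no ¬q  = contradiction (p⇒q p) ¬q
  ... | no _  | yes _  = m≤n⇒m≤1+n (length-filter-mono ps)
  ... | no _  | no _   = length-filter-mono ps

module _ {A : Set} {P Q R : Pred A 0ℓ} (P? : Decidable P) (Q? : Decidable Q) (R? : Decidable R) where

  length-filter-∪ : (∀ {x} → P x → Q x ⊎ R x) → ∀ xs →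
                    length (filter P? xs) ≤ length (filter Q? xs) + length (filter R? xs)
  length-filter-∪ split [] = z≤n
  length-filter-∪ split (x ∷ xs) with P? x | Q? x | R? x | length-filter-∪ split xs
  ... | yes p | yes _ | yes _ | ih = s≤s (≤-trans ih (≤-trans (n≤1+n _) (≤-reflexive (sym (+-suc _ _)))))
  ... | yes p | yes _ | no _  | ih = s≤s ih
  ... | yes p | no _  | yes _ | ih = ≤-trans (s≤s ih) (≤-reflexive (sym (+-suc _ _)))
  ... | no _  | yes _ | yes _ | ih = m≤n⇒m≤1+n (≤-trans ih (≤-trans (n≤1+n _) (≤-reflexive (sym (+-suc _ _)))))
  ... | no _  | yes _ | no _  | ih = m≤n⇒m≤1+n ih
  ... | no _  | no _  | yes _ | ih = ≤-trans (m≤n⇒m≤1+n ih) (≤-reflexive (sym (+-suc _ _)))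
  ... | no _  | no _  | no _  | ih = ih
  ... | yes p | no ¬q | no ¬r | ih with split p
  ...   | inj₁ q = contradiction q ¬q
  ...   | inj₂ r = contradiction r ¬r

  length-filter-⊎ : (∀ {x} → Q x → P x) → (∀ {x} → R x → P x) → (∀ {x} → Q x → ¬ R x) → ∀ xs →
                    length (filter Q? xs) + length (filter R? xs) ≤ length (filter P? xs)
  length-filter-⊎ Q⇒P R⇒P Q⇒¬R [] = z≤n
  length-filter-⊎ Q⇒P R⇒P Q⇒¬R (x ∷ xs) with P? x | Q? x | R? x | length-filter-⊎ Q⇒P R⇒P Q⇒¬R xs
  ... | _     | yes q | yes r | ih = contradiction r (Q⇒¬R q)
  ... | no ¬p | yes q | no _  | ih = contradiction (Q⇒P q) ¬p
  ... | no ¬p | no _  | yes r | ih = contradiction (R⇒P r) ¬p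
  ... | yes _ | yes _ | no _  | ih = s≤s ih
  ... | yes _ | no _  | yes _ | ih = ≤-trans (≤-reflexive (+-suc _ _)) (s≤s ih)
  ... | yes _ | no _  | no _  | ih = m≤n⇒m≤1+n ih
  ... | no _  | no _  | no _  | ih = ih

module _ {n : ℕ} where

  # : Fin n → List (Fin n) → ℕ
  # v xs = length (filter (_≟ v) xs)

  #-here : ∀ v xs → # v (v ∷ xs) ≡ suc (# v xs)
  #-here v xs with v ≟ v
  ... | yes _  = refl
  ... | no v≢v = contradiction refl v≢v

  #-there : ∀ {u v} → u ≢ v → ∀ xs → # v (u ∷ xs) ≡ # v xs
  #-there {u} {v} u≢v xs with u ≟ v
  ... | yes u≡v = contradiction u≡v u≢v
  ... | no _    = refl

  #-∷ : ∀ u v xs → # v xs ≤ # v (u ∷ xs)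
  #-∷ u v xs with u ≟ v
  ... | yes _ = n≤1+n _
  ... | no _  = ≤-refl

  #-↭ : ∀ {xs ys} v → xs ↭ ys → # v xs ≡ # v ys
  #-↭ v p = Perm.↭-length (Perm.filter-↭ (_≟ v) p)

  #-positive⇒∈ : ∀ {v} xs → 0 < # v xs → v ∈ xs
  #-positive⇒∈ {v} xs 0<# with filter (_≟ v) xs in eq
  ... | w ∷ ws with w∈xs , refl ← ∈-filter⁻ (_≟ v) (subst (w ∈_) (sym eq) (here refl)) = w∈xs

  ∈⇒#-positive : ∀ {v xs} → v ∈ xs → 0 < # v xs
  ∈⇒#-positive {v} v∈xs = filter-some (_≟ v) (Any.map sym v∈xs)

  #-cancel-∷ : ∀ x xs ys v → # v (x ∷ xs) ≤ # v (x ∷ ys) → # v xs ≤ # v ys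
  #-cancel-∷ x xs ys v le with x ≟ v
  ... | yes _ = ≤-pred le
  ... | no _  = le

  #-mono⇒length-mono : ∀ xs ys → (∀ v → # v xs ≤ # v ys) → length xs ≤ length ys
  #-mono⇒length-mono []       ys le = z≤n
  #-mono⇒length-mono (x ∷ xs) ys le
    with zs , ys↭ ← extract (#-positive⇒∈ {x} ys (≤-trans (≤-trans (s≤s z≤n) (≤-reflexive (sym (#-here x xs)))) (le x))) =
    ≤-trans (s≤s (#-mono⇒length-mono xs zs λ v → #-cancel-∷ x xs zs v (≤-trans (le v) (≤-reflexive (#-↭ v ys↭)))))
            (≤-reflexive (sym (Perm.↭-length ys↭)))

  module _ {P : Pred (Fin n) 0ℓ} (P? : Decidable P) where

    #-filter-yes : ∀ {v} → P v → ∀ xs → # v (filter P? xs) ≡ # v xs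
    #-filter-yes pv [] = refl
    #-filter-yes {v} pv (x ∷ xs) with P? x
    ... | yes _ with x ≟ v
    ...   | yes _ = cong suc (#-filter-yes pv xs)
    ...   | no _  = #-filter-yes pv xs
    #-filter-yes {v} pv (x ∷ xs) | no ¬px with x ≟ v
    ...   | yes refl = contradiction pv ¬px
    ...   | no _     = #-filter-yes pv xs

    #-filter-no : ∀ {v} → ¬ P v → ∀ xs → # v (filter P? xs) ≡ 0
    #-filter-no ¬pv [] = refl
    #-filter-no {v} ¬pv (x ∷ xs) with P? x
    ... | no _ = #-filter-no ¬pv xs
    ... | yes px with x ≟ v
    ...   | yes refl = contradiction px ¬pv
    ...   | no _     = #-filter-no ¬pv xs

    #-mono⇒length-filter-mono : ∀ xs ys → (∀ {v} → P v → # v xs ≤ # v ys) →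
                                length (filter P? xs) ≤ length (filter P? ys)
    #-mono⇒length-filter-mono xs ys le = #-mono⇒length-mono (filter P? xs) (filter P? ys) aux
      where
      aux : ∀ v → # v (filter P? xs) ≤ # v (filter P? ys)
      aux v with P? v
      ... | no ¬pv = ≤-trans (≤-reflexive (#-filter-no ¬pv xs)) z≤n
      ... | yes pv = ≤-trans (≤-reflexive (#-filter-yes pv xs)) (≤-trans (le pv) (≤-reflexive (sym (#-filter-yes pv ys))))

-- Reachability: a simple route or a separating set.

module _ {A : Set} (R : Rel A 0ℓ) (b : A) where

  -- Routes are simple because augmenting along a step changes the residual arcs at the node just
  -- left; the non-membership says that the rest of the route never returns there.
  data Route : A → List A → Set where
    stop : Route b []
    step : ∀ {a c vs} → R a c → Route c vs → a ∉ c ∷ vs → Route a (c ∷ vs)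

Route-map : ∀ {A : Set} {R S : Rel A 0ℓ} {b a vs} → (∀ {x y} → x ∈ a ∷ vs → R x y → S x y) →
            Route R b a vs → Route S b a vs
Route-map f stop                = stop
Route-map f (step r route a∉vs) = step (f (here refl) r) (Route-map (f ∘ there) route) a∉vs

record Barrier {A : Set} (R : Rel A 0ℓ) (a b : A) : Set₁ where
  field
    Side   : Pred A 0ℓ
    side?  : Decidable Side
    source : Side a
    target : ¬ Side b
    closed : ∀ {x y} → R x y → Side x → Side y

module Reachability {A : Set} (_≟ᴬ_ : DecidableEquality A) {R : Rel A 0ℓ} (R? : B.Decidable R) (b : A) where

  open import Data.List.Membership.DecPropositional _≟ᴬ_ using (_∈?_)

  Routed : List A → A → Set
  Routed L l = ∃[ vs ] (Route R b l vs × All (_∈ L) vs)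

  -- Backward search from `b`. A node outside `L` with an arc into `L` prolongs the route of that
  -- arc's head, and being new it keeps the route simple. The fuel `f` bounds the nodes still in
  -- `rest`.
  saturate : ∀ f L rest → length rest ≤ f → (∀ x → x ∈ L ⊎ x ∈ rest) → b ∈ L → (∀ {l} → l ∈ L → Routed L l) →
             ∃[ L′ ] (b ∈ L′ × (∀ {l} → l ∈ L′ → Routed L′ l) × (∀ {x y} → R x y → y ∈ L′ → x ∈ L′))
  saturate f L rest bound cover b∈L routed
    with any? (λ x → ¬? (x ∈? L) ×-dec any? (R? x) L) rest
  ... | no none = L , b∈L , routed , closed
    where
    closed : ∀ {x y} → R x y → y ∈ L → x ∈ L
    closed {x} r y∈L with x ∈? L | cover x
    ... | yes x∈L | _           = x∈L
    ... | no _    | inj₁ x∈L    = x∈L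
    ... | no x∉L  | inj₂ x∈rest =
      contradiction (Any.map (λ { refl → x∉L , Any.map (λ { refl → r }) y∈L }) x∈rest) none
  saturate f L rest bound cover b∈L routed | yes some
    with x , x∈rest , x∉L , xR ← find some
    with y , y∈L , r ← find xR
    with rest′ , rest↭ ← extract x∈rest
    with f | ≤-trans (≤-reflexive (sym (Perm.↭-length rest↭))) bound
  ... | suc f′ | s≤s bound′ = saturate f′ (x ∷ L) rest′ bound′ cover′ (there b∈L) routed′
    where
    cover′ : ∀ z → z ∈ x ∷ L ⊎ z ∈ rest′
    cover′ z with cover z
    ... | inj₁ z∈L = inj₁ (there z∈L)
    ... | inj₂ z∈rest with Perm.∈-resp-↭ rest↭ z∈rest
    ...   | here refl     = inj₁ (here refl)
    ...   | there z∈rest′ = inj₂ z∈rest′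

    weaken : ∀ {l} → Routed L l → Routed (x ∷ L) l
    weaken (vs , route , vs⊆L) = vs , route , All.map there vs⊆L

    routed′ : ∀ {l} → l ∈ x ∷ L → Routed (x ∷ L) l
    routed′ (there l∈L) = weaken (routed l∈L)
    routed′ (here refl) with vs , route , vs⊆L ← routed y∈L =
      y ∷ vs , step r route (λ x∈ → x∉L (All.lookup (y∈L ∷ vs⊆L) x∈)) , All.map there (y∈L ∷ vs⊆L)

  route⊎barrier : (nodes : List A) → (∀ x → x ∈ nodes) → ∀ a → (∃[ vs ] Route R b a vs) ⊎ Barrier R a b
  route⊎barrier nodes complete a
    with L , b∈L , routed , closed ← saturate (length nodes) (b ∷ []) nodes ≤-refl (inj₂ ∘ complete) (here refl)
           (λ { (here refl) → [] , stop , [] })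
    with a ∈? L
  ... | yes a∈L = inj₁ (proj₁ (routed a∈L) , proj₁ (proj₂ (routed a∈L)))
  ... | no a∉L  = inj₂ record
    { Side   = _∉ L
    ; side?  = λ x → ¬? (x ∈? L)
    ; source = a∉L
    ; target = λ b∉L → b∉L b∈L
    ; closed = λ r x∉L y∈L → x∉L (closed r y∈L)
    }

-- Augmenting a circulation with vertex capacities.

-- An arc uv runs from out u to inn v; pushing one more path through v uses inn v → out v.
data Node (n : ℕ) : Set where
  out inn : Fin n → Node n

_≟ᴺ_ : ∀ {n} → DecidableEquality (Node n)
out u ≟ᴺ out v = map′ (cong out) (λ { refl → refl }) (u ≟ v)
inn u ≟ᴺ inn v = map′ (cong inn) (λ { refl → refl }) (u ≟ v)
out _ ≟ᴺ inn _ = no λ ()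
inn _ ≟ᴺ out _ = no λ ()

allNodes : ∀ n → List (Node n)
allNodes n = map out (allFin n) ++ map inn (allFin n)

∈-allNodes : ∀ {n} (x : Node n) → x ∈ allNodes n
∈-allNodes (out v) = ∈-++⁺ˡ (∈-map⁺ out (∈-allFin v))
∈-allNodes {n} (inn v) = ∈-++⁺ʳ (map out (allFin n)) (∈-map⁺ inn (∈-allFin v))

Arcs : ℕ → Set
Arcs n = List (Fin n × Fin n)

tails heads : ∀ {n} → Arcs n → List (Fin n)
tails = map proj₁
heads = map proj₂

module _ {n : ℕ} (D : Digraph (Fin n)) where

  IsArc : Fin n × Fin n → Set
  IsArc (u , v) = Arc D u v

  record Circulation (E : Arcs n) : Set where
    constructor circulation
    field
      arcs     : All IsArc E
      balanced : tails E ↭ heads E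

module Augmentation {n : ℕ} (D : Digraph (Fin n)) (M : Fin n → ℕ) where

  -- The reverse out v → inn v of a through-arc is left out, so that augmenting never lowers a throughput.
  data Residual (E : Arcs n) (Z : List (Fin n)) : Node n → Node n → Set where
    forward  : ∀ {u v} → Arc D u v → Residual E Z (out u) (inn v)
    backward : ∀ {u v} → (u , v) ∈ E → Residual E Z (inn v) (out u)
    through  : ∀ {v} → # v Z < M v → Residual E Z (inn v) (out v)

  residual? : ∀ E Z → B.Decidable (Residual E Z)
  residual? E Z (out u) (out v) = no λ ()
  residual? E Z (inn u) (inn v) = no λ ()
  residual? E Z (out u) (inn v) = map′ forward (λ { (forward a) → a }) (arc? D u v)
  residual? E Z (inn v) (out u) =
    map′ (λ { (inj₁ e) → backward e ; (inj₂ (refl , lt)) → through lt })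
         (λ { (backward e) → inj₁ e ; (through lt) → inj₂ (refl , lt) })
         (any? (≡-dec _≟_ _≟_ (u , v)) E ⊎-dec ((u ≟ v) ×-dec (# v Z <? M v)))

  Above : List (Fin n) → Set
  Above Z = ∃[ E ] (Circulation D E × (∀ v → # v Z ≤ # v (tails E)) × (∀ v → # v (tails E) ≤ M v))

  module _ (i : Fin n) where

    -- A partially augmented circulation: when the augmenting route has reached out u, a
    -- tail u and a head i are still missing; when it has reached inn v, a head i is
    -- missing and a head v is in excess.
    augment-out : ∀ vs {u} E Z → Route (Residual E Z) (inn i) (out u) vs → All (IsArc D) E →
                  u ∷ tails E ↭ Z → i ∷ heads E ↭ Z → (∀ v → # v Z ≤ M v) → Above Z
    augment-inn : ∀ vs {v} E Z → Route (Residual E Z) (inn i) (inn v) vs → All (IsArc D) E →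
                  tails E ↭ Z → i ∷ heads E ↭ v ∷ Z → (∀ v → # v Z ≤ M v) → Above Z

    augment-out (inn v ∷ vs) {u} E Z (step (forward a) route _) arcs ts hs le =
      augment-inn vs ((u , v) ∷ E) Z (Route-map (λ _ → keep) route) (a ∷ arcs) ts
        (↭-trans (swap i v refl) (prep v hs)) le
      where
      keep : ∀ {x y} → Residual E Z x y → Residual ((u , v) ∷ E) Z x y
      keep (forward a)  = forward a
      keep (backward e) = backward (there e)
      keep (through lt) = through lt

    -- The route has arrived at `inn i`: the head in excess is the one that was missing.
    augment-inn [] E Z stop arcs ts hs le =
      E , circulation arcs (↭-trans ts (↭-sym (Perm.drop-∷ hs))) ,
      (λ v → ≤-reflexive (sym (#-↭ v ts))) , (λ v → ≤-trans (≤-reflexive (#-↭ v ts)) (le v))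
    augment-inn (out v ∷ vs) E Z (step (through lt) route v∉) arcs ts hs le =
      let E′ , circ , lo , hi = augment-out vs E (v ∷ Z) (Route-map keep route) arcs (prep v ts) hs le′
      in  E′ , circ , (λ w → ≤-trans (#-∷ v w Z) (lo w)) , hi
      where
      le′ : ∀ w → # w (v ∷ Z) ≤ M w
      le′ w with v ≟ w
      ... | yes refl = lt
      ... | no _     = le w

      keep : ∀ {x y} → x ∈ out v ∷ vs → Residual E Z x y → Residual E (v ∷ Z) x y
      keep _  (forward a)  = forward a
      keep _  (backward e) = backward e
      -- The rest of the route avoids `inn v`, so the capacity just used up at `v` is not asked for
      -- again.
      keep x∈ (through lt) = through (≤-trans (s≤s (≤-reflexive (#-there {u = v} (λ { refl → v∉ x∈ }) Z))) lt)
    augment-inn (out u ∷ vs) {v} E Z (step (backward e) route v∉) arcs ts hs le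
      with E′ , E↭ ← extract e =
      augment-out vs E′ Z (Route-map keep route) (All.tail (Perm.All-resp-↭ E↭ arcs))
        (↭-trans (↭-sym (Perm.map⁺ proj₁ E↭)) ts)
        (Perm.drop-∷ (↭-trans (swap v i refl) (↭-trans (prep i (↭-sym (Perm.map⁺ proj₂ E↭))) hs))) le
      where
      keep : ∀ {x y} → x ∈ out u ∷ vs → Residual E Z x y → Residual E′ Z x y
      keep _  (forward a)  = forward a
      keep _  (through lt) = through lt
      keep x∈ (backward e′) with Perm.∈-resp-↭ E↭ e′
      -- The deleted copy of the arc could only be reversed from `inn v`, where the route does not
      -- return; every other copy is still present.
      ... | here refl = contradiction x∈ v∉
      ... | there e″  = backward e″

    -- Write O = {v | out v ∈ Side} and I = {v | inn v ∈ Side}. Semicompleteness gives O ⊆ I ∪ {i},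
    -- closure says that the arcs of Y leave O into I and those of X enter I from O, and the vertices
    -- of I ∖ O are saturated by X. Counting throughputs, #ᵢ Y ≤ #(I ∖ O) Y ≤ #(I ∖ O) X ≤ #ᵢ X.
    no-barrier : Semicomplete D → ∀ {X Y} → Circulation D X → Circulation D Y →
                 (∀ v → # v (tails Y) ≤ M v) →
                 Barrier (Residual X (i ∷ tails X)) (out i) (inn i) → # i (tails Y) ≤ # i (tails X)
    no-barrier semi {X} {Y} (circulation arcsX balX) (circulation arcsY balY) Y≤M barrier =
      ≤-trans i≤ΔY (≤-trans ΔY≤ΔX ΔX≤i)
      where
      open Barrier barrier

      O? : Decidable (λ v → Side (out v))
      O? v = side? (out v)
      I? : Decidable (λ v → Side (inn v))
      I? v = side? (inn v)
      Δ? : Decidable (λ v → Side (inn v) × ¬ Side (out v))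
      Δ? v = I? v ×-dec ¬? (O? v)
      C? : Decidable (λ v → Side (inn v) × Side (out v))
      C? v = I? v ×-dec O? v

      O⇒I : ∀ {v} → Side (out v) → v ≢ i → Side (inn v)
      O⇒I {v} o v≢i with semi v i v≢i
      ... | inj₁ vi = contradiction (closed (forward vi) o) target
      ... | inj₂ iv = closed (forward iv) source

      O≤I : length (filter O? (tails Y)) ≤ length (filter I? (tails Y))
      O≤I = ≤-trans (length-filter-mono O? I? proj₁ proj₂ (All.map (λ a o → closed (forward a) o) arcsY))
                    (≤-reflexive (sym (Perm.↭-length (Perm.filter-↭ I? balY))))

      I≤O : length (filter I? (tails X)) ≤ length (filter O? (tails X))
      I≤O = ≤-trans (≤-reflexive (Perm.↭-length (Perm.filter-↭ I? balX)))
                    (length-filter-mono I? O? proj₂ proj₁ (All.tabulate (λ e → closed (backward e))))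

      -- Since `i` lies in O but not in I, #i + #C ≤ #O ≤ #I ≤ #Δ + #C in `Y`, where C = I ∩ O
      -- cancels. The same cancellation gives `ΔX≤i`.
      i≤ΔY : # i (tails Y) ≤ length (filter Δ? (tails Y))
      i≤ΔY = +-cancelʳ-≤ (length (filter C? (tails Y))) _ _
        (≤-trans (length-filter-⊎ O? (_≟ i) C? (λ { refl → source }) proj₂ (λ { refl (t , _) → target t }) (tails Y))
        (≤-trans O≤I (length-filter-∪ I? Δ? C? split (tails Y))))
        where
        split : ∀ {v} → Side (inn v) → (Side (inn v) × ¬ Side (out v)) ⊎ (Side (inn v) × Side (out v))
        split {v} s with O? v
        ... | yes o = inj₂ (s , o)
        ... | no ¬o = inj₁ (s , ¬o)

      ΔX≤i : length (filter Δ? (tails X)) ≤ # i (tails X)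
      ΔX≤i = +-cancelʳ-≤ (length (filter C? (tails X))) _ _
        (≤-trans (length-filter-⊎ I? Δ? C? proj₁ proj₁ (λ (_ , ¬o) (_ , o) → ¬o o) (tails X))
        (≤-trans I≤O (length-filter-∪ O? (_≟ i) C? split (tails X))))
        where
        split : ∀ {v} → Side (out v) → v ≡ i ⊎ (Side (inn v) × Side (out v))
        split {v} o with v ≟ i
        ... | yes v≡i = inj₁ v≡i
        ... | no v≢i  = inj₂ (O⇒I o v≢i , o)

      ΔY≤ΔX : length (filter Δ? (tails Y)) ≤ length (filter Δ? (tails X))
      -- Saturation is measured on `i ∷ tails X`, but `out i` is in `Side`, so `v` is not `i` and
      -- the extra entry does not count.
      ΔY≤ΔX = #-mono⇒length-filter-mono Δ? (tails Y) (tails X) λ {v} (s , ¬o) →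
        ≤-trans (Y≤M v) (≤-trans (≮⇒≥ (λ lt → ¬o (closed (through lt) s)))
          (≤-reflexive (#-there {u = i} (λ { refl → ¬o source }) (tails X))))

    -- A residual route from `out i` to `inn i` closes up through `i` to a cycle with one extra
    -- passage there. The residual digraph is taken at `i ∷ tails X`, which already counts that
    -- passage. Without a route, `no-barrier` contradicts the strict inequality.
    augment : Semicomplete D → ∀ {X Y} → Circulation D X → Circulation D Y →
              (∀ v → # v (tails X) ≤ M v) → (∀ v → # v (tails Y) ≤ M v) →
              # i (tails X) < # i (tails Y) → Above (i ∷ tails X)
    augment semi {X} {Y} cX cY X≤M Y≤M lt
      with Reachability.route⊎barrier _≟ᴺ_ (residual? X (i ∷ tails X)) (inn i) (allNodes n) ∈-allNodes (out i)
    ... | inj₂ barrier = contradiction (<-≤-trans lt (no-barrier semi cX cY Y≤M barrier)) (<-irrefl refl)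
    ... | inj₁ (vs , route) =
      augment-out vs X (i ∷ tails X) route (Circulation.arcs cX) refl (prep i (↭-sym (Circulation.balanced cX))) le
      where
      le : ∀ v → # v (i ∷ tails X) ≤ M v
      le v with i ≟ v
      ... | yes refl = ≤-trans lt (Y≤M v)
      ... | no _     = X≤M v

-- Turning circulations into closed walks through a given vertex.

module _ {n : ℕ} (D : Digraph (Fin n)) where

  -- The list holds the tails of the arcs of the walk, so the last vertex is left out.
  data Walk : Fin n → List (Fin n) → Fin n → Set where
    []  : ∀ {u} → Walk u [] u
    _∷_ : ∀ {u v w ws} → Arc D u v → Walk v ws w → Walk u (u ∷ ws) w

module _ {n : ℕ} {D : Digraph (Fin n)} where

  open import Data.List.Membership.DecPropositional (_≟_ {n}) using (_∈?_)
  open PermutationReasoning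

  infixr 5 _++ʷ_

  _++ʷ_ : ∀ {u v w us vs} → Walk D u us v → Walk D v vs w → Walk D u (us ++ vs) w
  []      ++ʷ q = q
  (a ∷ p) ++ʷ q = a ∷ (p ++ʷ q)

  start∈ : ∀ {u v ws} → Walk D u ws v → u ∈ v ∷ ws
  start∈ []      = here refl
  start∈ (_ ∷ _) = there (here refl)

  last-arc : ∀ {u v ws} → Walk D u (u ∷ ws) v → ∃[ c ] ∃[ ws′ ] (Walk D u ws′ c × Arc D c v × c ∷ ws′ ↭ u ∷ ws)
  last-arc (a ∷ [])          = _ , _ , [] , a , refl
  last-arc {u} (a ∷ (b ∷ p)) with c , ws′ , q , e , eq ← last-arc (b ∷ p) =
    c , u ∷ ws′ , a ∷ q , e , ↭-trans (swap c u refl) (prep u eq)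

  split-at : ∀ {u v c ws} → Walk D u ws v → c ∈ ws →
             ∃[ xs ] ∃[ ys ] (Walk D u xs c × Walk D c (c ∷ ys) v × xs ++ c ∷ ys ≡ ws)
  split-at (a ∷ p) (here refl) = [] , _ , [] , a ∷ p , refl
  split-at {u} (a ∷ p) (there c∈) with xs , ys , q , r , refl ← split-at p c∈ = u ∷ xs , ys , a ∷ q , r , refl

  rotate : ∀ {a c cs} → Walk D a cs a → c ∈ cs → ∃[ ws ] (Walk D c (c ∷ ws) c × c ∷ ws ↭ cs)
  rotate {c = c} p c∈ with xs , ys , q , r , refl ← split-at p c∈ = ys ++ xs , r ++ʷ q , Perm.++-comm (c ∷ ys) xs

  walk⇒arcs : ∀ {u v ws} → Walk D u ws v → ∃[ E ] (All (IsArc D) E × tails E ≡ ws × u ∷ heads E ↭ v ∷ ws)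
  walk⇒arcs [] = [] , [] , refl , refl
  walk⇒arcs {u} {v} (a ∷ p) with E , arcs , refl , hs ← walk⇒arcs p =
    (u , _) ∷ E , a ∷ arcs , refl , ↭-trans (prep u hs) (swap u v refl)

  closed-walk⇒circulation : ∀ {u ws} → Walk D u ws u → ∃[ E ] (Circulation D E × tails E ≡ ws)
  closed-walk⇒circulation p with E , arcs , refl , hs ← walk⇒arcs p =
    E , circulation arcs (↭-sym (Perm.drop-∷ hs)) , refl

  close-up : ∀ f {a b ws} E → length E ≤ f → All (IsArc D) E → Walk D a (a ∷ ws) b → a ∷ tails E ↭ b ∷ heads E →
             ∃[ ws′ ] ∃[ E′ ] (Walk D a (a ∷ ws′) a × Circulation D E′ × (a ∷ ws′) ++ tails E′ ↭ (a ∷ ws) ++ tails E ×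
                               length E′ ≤ length E)
  close-up f {a} {b} {ws} E bound arcs p bal with b ≟ a
  ... | yes refl = ws , E , p , circulation arcs (Perm.drop-∷ bal) , refl , ≤-refl
  ... | no b≢a with Perm.∈-resp-↭ (↭-sym bal) (here refl)
  ...   | here b≡a = contradiction b≡a b≢a
  ...   | there b∈ with ∈-map⁻ proj₁ b∈
  ...     | (.b , c) , e∈ , refl with E₁ , E↭ ← extract e∈ with f | ≤-trans (≤-reflexive (sym (Perm.↭-length E↭))) bound
  ...       | suc f′ | s≤s bound′
    with a₁ ∷ arcs₁ ← Perm.All-resp-↭ E↭ arcs =
    let ws′ , E′ , q , circ , eq , le = close-up f′ E₁ bound′ arcs₁ (p ++ʷ (a₁ ∷ [])) bal₁
    in  ws′ , E′ , q , circ , ↭-trans eq eq₁ , ≤-trans le (≤-trans (n≤1+n _) (≤-reflexive (sym (Perm.↭-length E↭))))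
    where
    bal₁ : a ∷ tails E₁ ↭ c ∷ heads E₁
    bal₁ = Perm.drop-∷ (begin
      b ∷ a ∷ tails E₁ ↭⟨ swap b a refl ⟩
      a ∷ b ∷ tails E₁ ↭⟨ prep a (Perm.map⁺ proj₁ E↭) ⟨
      a ∷ tails E      ↭⟨ bal ⟩
      b ∷ heads E      ↭⟨ prep b (Perm.map⁺ proj₂ E↭) ⟩
      b ∷ c ∷ heads E₁ ∎)

    eq₁ : (a ∷ ws ++ b ∷ []) ++ tails E₁ ↭ (a ∷ ws) ++ tails E
    eq₁ = begin
      (a ∷ ws ++ b ∷ []) ++ tails E₁ ≡⟨ ++-assoc (a ∷ ws) (b ∷ []) (tails E₁) ⟩
      (a ∷ ws) ++ b ∷ tails E₁       ↭⟨ Perm.++⁺ˡ (a ∷ ws) (Perm.map⁺ proj₁ E↭) ⟨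
      (a ∷ ws) ++ tails E            ∎

  module _ (semi : Semicomplete D) (s : Fin n) (s→ : ∀ {v} → v ≢ s → Arc D s v) (→s : ∀ {v} → v ≢ s → Arc D v s) where

    module _ {a cs} (C : Walk D a (a ∷ cs) a) where

      -- C with an arc c d removed, where the end c of the remaining walk is joined to p.
      Exit : Fin n → Set
      Exit p = ∃[ d ] ∃[ ws ] ∃[ c ] (Walk D d ws c × Arc D c p × c ∷ ws ↭ a ∷ cs)

      Dominates : Fin n → Set
      Dominates p = ∀ {d} → d ∈ a ∷ cs → Arc D p d

      exit : ∀ {c p} → c ∈ a ∷ cs → Arc D c p → Exit p
      exit c∈ e with ws , _ ∷ q , eq ← rotate C c∈ = _ , ws , _ , q , e , eq

      -- If `p` is on `C`, remove an arc of `C` that enters `p`. If it is off `C` and receives no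
      -- arc from it, semicompleteness directs every arc from `p` to `C`.
      exit⊎dominates : ∀ p → Exit p ⊎ Dominates p
      exit⊎dominates p with p ∈? (a ∷ cs)
      ... | yes p∈ with ws , q , eq ← rotate C p∈ with c , ws′ , r , e , eq′ ← last-arc q =
        inj₁ (p , ws′ , c , r , e , ↭-trans eq′ eq)
      ... | no p∉ with any? (λ c → arc? D c p) (a ∷ cs)
      ...   | yes some with c , c∈ , e ← find some = inj₁ (exit c∈ e)
      ...   | no none = inj₂ dominates
        where
        dominates : Dominates p
        dominates {d} d∈ with semi p d (λ { refl → p∉ d∈ })
        ... | inj₁ pd = pd
        ... | inj₂ dp = contradiction (Any.map (λ { refl → dp }) d∈) none

      -- The walk starts at a vertex dominating `C` and ends at `s`, which has an exit. Hence it has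
      -- an arc from a dominating vertex to one with an exit, and that arc is replaced by a detour
      -- around all of `C`.
      insert : ∀ {u us} → Exit s → Dominates u → Walk D u (u ∷ us) s →
               ∃[ us′ ] (Walk D u (u ∷ us′) s × u ∷ us′ ↭ (u ∷ us) ++ (a ∷ cs))
      insert {u} {us} exit-s dom (e ∷ p) with next p
        where
        next : ∀ {v vs} → Walk D v vs s → Exit v ⊎ (Dominates v × ∃[ vs′ ] vs ≡ v ∷ vs′)
        next []            = inj₁ exit-s
        next {v} (e′ ∷ p′) with exit⊎dominates v
        ... | inj₁ ex   = inj₁ ex
        ... | inj₂ dom′ = inj₂ (dom′ , _ , refl)
      ... | inj₁ (d , ws , c , q , e′ , eq) =
        ws ++ c ∷ us , dom (Perm.∈-resp-↭ eq (start∈ q)) ∷ (q ++ʷ e′ ∷ p) , prep u (begin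
          ws ++ c ∷ us      ↭⟨ Perm.shift c ws us ⟩
          (c ∷ ws) ++ us    ↭⟨ Perm.++⁺ʳ us eq ⟩
          (a ∷ cs) ++ us    ↭⟨ Perm.++-comm (a ∷ cs) us ⟩
          us ++ (a ∷ cs)    ∎)
      ... | inj₂ (dom′ , vs , refl) with us′ , q , eq ← insert exit-s dom′ p = _ , e ∷ q , prep u eq

      merge : ∀ {ps} → Walk D s (s ∷ ps) s → ∃[ qs ] (Walk D s (s ∷ qs) s × s ∷ qs ↭ (s ∷ ps) ++ (a ∷ cs))
      merge {ps} P with s ∈? (a ∷ cs)
      ... | yes s∈ with ws , q , eq ← rotate C s∈ = ps ++ s ∷ ws , P ++ʷ q , Perm.++⁺ˡ (s ∷ ps) eq
      -- When `s` is off `C`, it is joined to every vertex of `C` in both directions.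
      ... | no s∉ = insert (exit (here refl) (→s λ { refl → s∉ (here refl) })) (λ d∈ → s→ λ { refl → s∉ d∈ }) P

    -- Each round closes up the first remaining arc to a closed walk and merges it into the walk at
    -- `s`, so the number of remaining arcs drops.
    absorb : ∀ f {ps} E → length E ≤ f → Walk D s (s ∷ ps) s → Circulation D E →
             ∃[ qs ] (Walk D s (s ∷ qs) s × s ∷ qs ↭ (s ∷ ps) ++ tails E)
    absorb f {ps} [] _ P _ = ps , P , ↭-sym (Perm.++-identityʳ (s ∷ ps))
    absorb (suc f) {ps} ((a , b) ∷ E) (s≤s bound) P (circulation (e ∷ arcs) bal)
      with cs , E′ , C , circ , eq , le ← close-up (length E) E ≤-refl arcs (e ∷ []) bal
      with ps′ , P′ , eq′ ← merge C P
      with qs , Q , eq″ ← absorb f E′ (≤-trans le bound) P′ circ =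
      qs , Q , (begin
        s ∷ qs                            ↭⟨ eq″ ⟩
        (s ∷ ps′) ++ tails E′             ↭⟨ Perm.++⁺ʳ (tails E′) eq′ ⟩
        ((s ∷ ps) ++ (a ∷ cs)) ++ tails E′ ≡⟨ ++-assoc (s ∷ ps) (a ∷ cs) (tails E′) ⟩
        (s ∷ ps) ++ (a ∷ cs) ++ tails E′  ↭⟨ Perm.++⁺ˡ (s ∷ ps) eq ⟩
        (s ∷ ps) ++ a ∷ tails E           ∎)

    circulation⇒closed-walk : ∀ {E} → Circulation D E → s ∈ tails E → ∃[ ws ] (Walk D s ws s × ws ↭ tails E)
    circulation⇒closed-walk {E} (circulation arcs bal) s∈ with ∈-map⁻ proj₁ s∈
    ... | (.s , c) , e∈ , refl
      with E₁ , E↭ ← extract e∈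
      with e ∷ arcs₁ ← Perm.All-resp-↭ E↭ arcs
      with ps , E′ , P , circ , eq , _ ← close-up (length E₁) E₁ ≤-refl arcs₁ (e ∷ [])
             (↭-trans (↭-sym (Perm.map⁺ proj₁ E↭)) (↭-trans bal (Perm.map⁺ proj₂ E↭)))
      with qs , Q , eq′ ← absorb (length E′) E′ ≤-refl P circ =
      s ∷ qs , Q , ↭-trans eq′ (↭-trans eq (↭-sym (Perm.map⁺ proj₁ E↭)))

    -- Augments one passage at a time; `f` bounds the deficit at `i` compared with `Y`. As no
    -- throughput is lowered, `s` stays visited and every circulation on the way is again a closed
    -- walk at `s`.
    enlarge : ∀ (M : Fin n → ℕ) i f {X Y} → Walk D s X s → Walk D s Y s → s ∈ X →
              (∀ v → # v X ≤ M v) → (∀ v → # v Y ≤ M v) → # i Y ≤ f + # i X →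
              ∃[ Z ] (Walk D s Z s × (∀ v → # v X ≤ # v Z) × (∀ v → # v Z ≤ M v) × # i Y ≤ # i Z)
    enlarge M i zero {X} p q s∈X X≤M Y≤M le = X , p , (λ _ → ≤-refl) , X≤M , le
    enlarge M i (suc f) {X} {Y} p q s∈X X≤M Y≤M le with # i X <? # i Y
    ... | no ≮ = X , p , (λ _ → ≤-refl) , X≤M , ≮⇒≥ ≮
    ... | yes lt
      with _ , cX , refl ← closed-walk⇒circulation p
      with _ , cY , refl ← closed-walk⇒circulation q
      with E , circ , lo , hi ← Augmentation.augment D M i semi cX cY X≤M Y≤M lt
      with s∈E ← #-positive⇒∈ (tails E) (≤-trans (∈⇒#-positive s∈X) (≤-trans (#-∷ i s X) (lo s)))
      with W , r , W↭ ← circulation⇒closed-walk circ s∈E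
      with Z , z , W≤Z , Z≤M , done ← enlarge M i f r q (Perm.∈-resp-↭ (↭-sym W↭) s∈E)
             (λ v → ≤-trans (≤-reflexive (#-↭ v W↭)) (hi v)) Y≤M
             (≤-trans le (≤-trans (≤-reflexive (sym (+-suc f (# i X))))
               (+-monoʳ-≤ f (≤-trans (≤-reflexive (sym (#-here i X))) (≤-trans (lo i) (≤-reflexive (sym (#-↭ i W↭)))))))) =
      Z , z , (λ v → ≤-trans (#-∷ i v X) (≤-trans (lo v) (≤-trans (≤-reflexive (sym (#-↭ v W↭))) (W≤Z v)))) , Z≤M , done

-- Lists without repetitions, and lists of bounded length.

module _ {A : Set} where

  Unique-⊆⇒length≤ : ∀ {xs ys : List A} → Unique xs → (∀ {v} → v ∈ xs → v ∈ ys) → length xs ≤ length ys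
  Unique-⊆⇒length≤ [] _ = z≤n
  Unique-⊆⇒length≤ {x ∷ xs} (x∉ ∷ uniq) xs⊆ys with zs , ys↭ ← extract (xs⊆ys (here refl)) =
    ≤-trans (s≤s (Unique-⊆⇒length≤ uniq xs⊆zs)) (≤-reflexive (sym (Perm.↭-length ys↭)))
    where
    xs⊆zs : ∀ {v} → v ∈ xs → v ∈ zs
    xs⊆zs v∈xs with Perm.∈-resp-↭ ys↭ (xs⊆ys (there v∈xs))
    ... | here v≡x   = contradiction (sym v≡x) (All.lookup x∉ v∈xs)
    ... | there v∈zs = v∈zs

  Unique-++⁻ : ∀ (xs : List A) {ys} → Unique (xs ++ ys) → Unique xs × Unique ys × Disjoint xs ys
  Unique-++⁻ []       uniq        = [] , uniq , λ ()
  Unique-++⁻ (x ∷ xs) (x∉ ∷ uniq) with uxs , uys , disj ← Unique-++⁻ xs uniq =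
    AllP.++⁻ˡ xs x∉ ∷ uxs , uys , λ
      { (here refl , v∈ys) → All.lookup (AllP.++⁻ʳ xs x∉) v∈ys refl
      ; (there v∈xs , v∈ys) → disj (v∈xs , v∈ys) }

  Unique-concat⁻ : ∀ (xss : List (List A)) → Unique (concat xss) → All Unique xss × AllPairs Disjoint xss
  Unique-concat⁻ []         _    = [] , []
  Unique-concat⁻ (xs ∷ xss) uniq
    with uxs , urest , disj ← Unique-++⁻ xs uniq
    with us , disjs ← Unique-concat⁻ xss urest =
    uxs ∷ us , All.tabulate (λ ys∈ (v∈xs , v∈ys) → disj (v∈xs , ∈-concat⁺′ v∈ys ys∈)) ∷ disjs

  -- Two equal entries would lie in the same fibre.
  Unique-fibres : ∀ {n} (f : A → Fin n) L → (∀ j → Unique (filter (λ v → f v ≟ j) L)) → Unique L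
  Unique-fibres f []      _    = []
  Unique-fibres f (x ∷ L) uniq = All.tabulate x∉ ∷ Unique-fibres f L uniq-L
    where
    x∉ : ∀ {y} → y ∈ L → x ≢ y
    x∉ y∈L refl with f x ≟ f x | uniq (f x)
    ... | yes _ | x∉ ∷ _ = All.lookup x∉ (∈-filter⁺ (λ v → f v ≟ f x) y∈L refl) refl
    ... | no ≢  | _      = ≢ refl

    uniq-L : ∀ j → Unique (filter (λ v → f v ≟ j) L)
    uniq-L j with f x ≟ j | uniq j
    ... | yes _ | _ ∷ u = u
    ... | no _  | u     = u

  #-map : ∀ {n} (f : A → Fin n) j L → # j (map f L) ≡ length (filter (λ v → f v ≟ j) L)
  #-map f j []      = refl
  #-map f j (x ∷ L) with f x ≟ j
  ... | yes _ = cong suc (#-map f j L)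
  ... | no _  = #-map f j L

  -- The junction is stated for all of `xs` because in a composition an arc of `T` leaves every
  -- vertex of a segment, so the last one need not be singled out.
  Linked-++⁺ : ∀ {R : Rel A 0ℓ} {xs ys} → Linked R xs → Linked R ys →
               (∀ {x y ys′} → x ∈ xs → ys ≡ y ∷ ys′ → R x y) → Linked R (xs ++ ys)
  Linked-++⁺ []                 l _ = l
  Linked-++⁺ {ys = []}    [-]   l _ = [-]
  Linked-++⁺ {ys = _ ∷ _} [-]   l r = r (here refl) refl ∷ l
  Linked-++⁺ (a ∷ as)           l r = a ∷ Linked-++⁺ as l (r ∘ there)

  listsUpTo : List A → ℕ → List (List A)
  listsUpTo as zero    = [] ∷ []
  listsUpTo as (suc n) = [] ∷ cartesianProductWith _∷_ as (listsUpTo as n)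

  ∈-listsUpTo : ∀ {as n xs} → All (_∈ as) xs → length xs ≤ n → xs ∈ listsUpTo as n
  ∈-listsUpTo {n = zero}  []         _         = here refl
  ∈-listsUpTo {n = suc n} []         _         = here refl
  ∈-listsUpTo {n = suc n} (x∈ ∷ xs∈) (s≤s len) = there (∈-cartesianProductWith⁺ _∷_ x∈ (∈-listsUpTo xs∈ len))

-- The apex digraph.

module _ {t : ℕ} (T : Digraph (Fin t)) where

  ApexArc : Fin (suc t) → Fin (suc t) → Set
  ApexArc zero    zero    = ⊥
  ApexArc zero    (suc _) = ⊤
  ApexArc (suc _) zero    = ⊤
  ApexArc (suc u) (suc v) = Arc T u v

  apex : Digraph (Fin (suc t))
  apex = record { Arc = ApexArc ; arc? = dec ; noLoop = irr }
    where
    dec : B.Decidable ApexArc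
    dec zero    zero    = no λ ()
    dec zero    (suc _) = yes tt
    dec (suc _) zero    = yes tt
    dec (suc u) (suc v) = arc? T u v

    irr : ∀ u → ¬ ApexArc u u
    irr (suc u) = noLoop T u

  apex-semicomplete : Semicomplete T → Semicomplete apex
  apex-semicomplete semi zero    zero    u≢v = contradiction refl u≢v
  apex-semicomplete semi zero    (suc _) _   = inj₁ tt
  apex-semicomplete semi (suc _) zero    _   = inj₁ tt
  apex-semicomplete semi (suc u) (suc v) u≢v = semi u v (u≢v ∘ cong suc)

  apex→ : ∀ {v} → v ≢ zero → ApexArc zero v
  apex→ {zero}  v≢ = contradiction refl v≢
  apex→ {suc _} _  = tt

  →apex : ∀ {v} → v ≢ zero → ApexArc v zero
  →apex {zero}  v≢ = contradiction refl v≢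
  →apex {suc _} _  = tt

-- Path subdigraphs of the composition as labelled closed walks.

module Composition {t : ℕ} {m : Fin t → ℕ} (T : Digraph (Fin t)) (H : (i : Fin t) → Digraph (Fin (m i))) where

  Q : Digraph (Vertex m)
  Q = T [ H ]

  IsPath : List (Vertex m) → Set
  IsPath p = p ≢ [] × Linked (Arc Q) p

  isPath? : Decidable IsPath
  isPath? []      = no λ (≢[] , _) → ≢[] refl
  isPath? (x ∷ p) = map′ (λ l → (λ ()) , l) proj₂ (linked? (arc? Q) (x ∷ p))

  assemble : ∀ ps → All IsPath ps → All Unique ps → ∃[ qs ] map (vertices {D = Q}) qs ≡ ps
  assemble []       []                  []       = [] , refl
  assemble (p ∷ ps) ((ne , link) ∷ paths) (u ∷ us) with qs , refl ← assemble ps paths us =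
    record { vertices = p ; nonempty = ne ; distinct = u ; linked = link } ∷ qs , refl

  pathSubdigraph : ∀ ps → All IsPath ps → Unique (concat ps) → Σ[ F ∈ PathSubdigraph Q (length ps) ] covered F ≡ concat ps
  pathSubdigraph ps paths uniq
    with us , disj ← Unique-concat⁻ ps uniq
    with qs , refl ← assemble ps paths us =
    record { paths = qs ; count = sym (length-map vertices qs) ; disjoint = disj } , refl

  -- A k-path subdigraph of Q is encoded as a closed walk at the apex zero, visited k times,
  -- where each visit to suc j carries a path inside H j and each visit to zero the empty list.
  Segment : Fin (suc t) → List (Vertex m) → Set
  Segment zero    seg = seg ≡ []
  Segment (suc j) seg = IsPath seg × All (λ v → proj₁ v ≡ j) seg

  Item : Set
  Item = Fin (suc t) × List (Vertex m)

  Valid : Item → Set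
  Valid (l , seg) = Segment l seg

  labels : List Item → List (Fin (suc t))
  labels = map proj₁

  content : List Item → List (Vertex m)
  content its = concat (map proj₂ its)

  ClosedWalk : List (Fin (suc t)) → Set
  ClosedWalk Z = Walk (apex T) zero Z zero

  record Code (k : ℕ) (L : List (Vertex m)) : Set where
    field
      items    : List Item
      walk     : ClosedWalk (labels items)
      valid    : All Valid items
      contents : content items ≡ L
      visits   : # zero (labels items) ≡ k

  -- Read from its end, the path grows its first segment at an `inside` arc and opens a new one at a
  -- `between` arc; hence the first item is kept explicit.
  encode-path : ∀ {its} → ClosedWalk (labels its) → All Valid its → ∀ x xs → Linked (Arc Q) (x ∷ xs) →
                ∃[ seg ] ∃[ its′ ] let its″ = (suc (proj₁ x) , x ∷ seg) ∷ its′ in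
                  Walk (apex T) (suc (proj₁ x)) (labels its″) zero × All Valid its″ ×
                  content its″ ≡ (x ∷ xs) ++ content its × # zero (labels its″) ≡ # zero (labels its)
  encode-path {its} walk valid x [] [-] =
    [] , its , tt ∷ walk , (((λ ()) , [-]) , refl ∷ []) ∷ valid , refl , refl
  encode-path walk valid (i , x) ((j , y) ∷ xs) (a ∷ link)
    with seg , its′ , e ∷ walk′ , ((ne , seg-link) , part) ∷ valid′ , eq , visits ← encode-path walk valid (j , y) xs link
    with a
  ... | inside b   = (j , y) ∷ seg , its′ , e ∷ walk′ ,
                     (((λ ()) , inside b ∷ seg-link) , refl ∷ part) ∷ valid′ , cong ((i , x) ∷_) eq , visits
  ... | between ij = [] , (suc j , (j , y) ∷ seg) ∷ its′ , ij ∷ (e ∷ walk′) ,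
                     (((λ ()) , [-]) , refl ∷ []) ∷ ((ne , seg-link) , part) ∷ valid′ , cong ((i , x) ∷_) eq , visits

  encode : (ps : List (Path Q)) → Code (length ps) (concat (map vertices ps))
  encode [] = record { items = [] ; walk = [] ; valid = [] ; contents = refl ; visits = refl }
  encode (record { vertices = [] ; nonempty = ne } ∷ ps) = contradiction refl ne
  encode (record { vertices = x ∷ xs ; linked = link } ∷ ps)
    with record { walk = walk ; valid = valid ; contents = eq₀ ; visits = visits } ← encode ps
    with seg , its′ , walk′ , valid′ , eq , visits′ ← encode-path walk valid x xs link =
    record { items    = (zero , []) ∷ (suc (proj₁ x) , x ∷ seg) ∷ its′
           ; walk     = tt ∷ walk′
           ; valid    = refl ∷ valid′
           ; contents = trans eq (cong ((x ∷ xs) ++_) eq₀)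
           ; visits   = cong suc (trans visits′ visits)
           }

  StartsIn : Fin (suc t) → List (Vertex m) → Set
  StartsIn zero    p = p ≡ []
  StartsIn (suc j) p = ∃[ x ] ∃[ xs ] (p ≡ x ∷ xs × proj₁ x ≡ j)

  -- For the induction the walk may start anywhere: `p` is the part of a path read before the next
  -- visit to the apex, and `StartsIn` tells which arc of `T` leads into it.
  decode-from : ∀ {u} its → Walk (apex T) u (labels its) zero → All Valid its →
                ∃[ p ] ∃[ ps ] (Linked (Arc Q) p × StartsIn u p × All IsPath ps ×
                                p ++ concat ps ≡ content its × length ps ≡ # zero (labels its))
  decode-from [] [] [] = [] , [] , [] , refl , [] , refl , refl
  -- The apex has no loop, so its successor is some `suc j` and the path opened here is nonempty.
  decode-from ((zero , .[]) ∷ its) (_∷_ {v = suc _} _ walk) (refl ∷ valid)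
    with p , ps , link , (x , xs , refl , _) , paths , eq , len ← decode-from its walk valid =
    [] , p ∷ ps , [] , refl , ((λ ()) , link) ∷ paths , eq , cong suc len
  decode-from ((suc j , []) ∷ its) (a ∷ walk) (((ne , _) , _) ∷ valid) = contradiction refl ne
  decode-from ((suc j , y ∷ seg) ∷ its) (_∷_ {v = v} a walk) (((ne , seg-link) , part) ∷ valid)
    with p , ps , link , start , paths , eq , len ← decode-from its walk valid =
    (y ∷ seg) ++ p , ps , Linked-++⁺ seg-link link (join v a start) , (y , _ , refl , All.head part) , paths ,
    trans (++-assoc (y ∷ seg) p (concat ps)) (cong ((y ∷ seg) ++_) eq) , len
    where
    join : ∀ v → ApexArc T (suc j) v → StartsIn v p → ∀ {x z zs} → x ∈ y ∷ seg → p ≡ z ∷ zs → Arc Q x z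
    join zero    a refl               x∈ ()
    join (suc _) a (_ , _ , refl , refl) x∈ refl with refl ← All.lookup part x∈ = between a

  decode : ∀ {k L} → Code k L → Unique L → Σ[ F ∈ PathSubdigraph Q k ] covered F ≡ L
  decode record { items = its ; walk = walk ; valid = valid ; contents = refl ; visits = refl } uniq
    with .[] , ps , _ , refl , paths , eq , len ← decode-from its walk valid
    with F , cov ← pathSubdigraph ps paths (subst Unique (sym eq) uniq) =
    subst (λ k → Σ[ F ∈ PathSubdigraph Q k ] covered F ≡ content its) len (F , trans cov eq)

  segments : Fin (suc t) → List Item → List (List (Vertex m))
  segments l its = map proj₂ (filter (λ it → proj₁ it ≟ l) its)

  part? : ∀ j → Decidable (λ (v : Vertex m) → proj₁ v ≡ j)
  part? j v = proj₁ v ≟ j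

  length-segments : ∀ l its → length (segments l its) ≡ # l (labels its)
  length-segments l its = trans (length-map proj₂ (filter (λ it → proj₁ it ≟ l) its)) (sym (#-map proj₁ l its))

  segments-valid : ∀ l {its} → All Valid its → All (Segment l) (segments l its)
  segments-valid l [] = []
  segments-valid l {(l′ , _) ∷ _} (v ∷ valid) with l′ ≟ l
  ... | yes refl = v ∷ segments-valid l valid
  ... | no _     = segments-valid l valid

  filter-other : ∀ {l j seg} → l ≢ suc j → Segment l seg → filter (part? j) seg ≡ []
  filter-other {zero}  l≢ refl       = refl
  filter-other {suc _} l≢ (_ , part) = filter-none (part? _) (All.map (λ { refl refl → l≢ refl }) part)

  -- Every segment lies within one part, so filtering by a part keeps or drops it as a whole.
  concat-segments : ∀ j {its} → All Valid its → concat (segments (suc j) its) ≡ filter (part? j) (content its)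
  concat-segments j [] = refl
  concat-segments j {(l , seg) ∷ its} (v ∷ valid) rewrite filter-++ (part? j) seg (content its) with l ≟ suc j
  ... | yes refl rewrite filter-all (part? j) (proj₂ v) = cong (seg ++_) (concat-segments j valid)
  ... | no l≢    rewrite filter-other l≢ v              = concat-segments j valid

  pop : Fin (suc t) → (Fin (suc t) → List (List (Vertex m))) → Fin (suc t) → List (List (Vertex m))
  pop a S l with a ≟ l
  ... | yes _ = drop 1 (S l)
  ... | no _  = S l

  -- The successive visits to `l` consume the entries of `S l` in order, one each.
  distribute : ∀ Z (S : Fin (suc t) → List (List (Vertex m))) → (∀ l → length (S l) ≡ # l Z) → (∀ l → All (Segment l) (S l)) →
               ∃[ its ] (labels its ≡ Z × All Valid its × (∀ l → segments l its ≡ S l))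
  distribute [] S len valid = [] , refl , [] , λ l → empty (S l) (len l)
    where
    empty : ∀ (xs : List (List (Vertex m))) → length xs ≡ 0 → [] ≡ xs
    empty [] _ = refl
  distribute (a ∷ Z) S len valid with S a in eq | trans (sym (#-here a Z)) (sym (len a)) | valid a
  ... | seg ∷ segs | _ | v ∷ _ =
    let its , labels≡ , valid′ , segs≡ = distribute Z (pop a S) len′ valid″
    in  (a , seg) ∷ its , cong (a ∷_) labels≡ , v ∷ valid′ , restore its segs≡
    where
    len′ : ∀ l → length (pop a S l) ≡ # l Z
    len′ l with a ≟ l | len l
    ... | yes refl | p rewrite eq = suc-injective p
    ... | no _     | p = p

    valid″ : ∀ l → All (Segment l) (pop a S l)
    valid″ l with a ≟ l
    ... | yes _ = AllP.drop⁺ 1 (valid l)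
    ... | no _  = valid l

    restore : ∀ its → (∀ l → segments l its ≡ pop a S l) → ∀ l → segments l ((a , seg) ∷ its) ≡ S l
    restore its segs≡ l with a ≟ l | segs≡ l
    ... | yes refl | p rewrite eq = cong (seg ∷_) p
    ... | no _     | p = p

  -- Systems of disjoint paths inside one part.

  vertex : ∀ j → Fin (m j) → Vertex m
  vertex j x = j , x

  part : ∀ j → List (Vertex m)
  part j = map (vertex j) (allFin (m j))

  length-part : ∀ j → length (part j) ≡ m j
  length-part j = trans (length-map (vertex j) (allFin (m j))) (length-tabulate id)

  ∈-part : ∀ {j} {v : Vertex m} → proj₁ v ≡ j → v ∈ part j
  ∈-part {v = j , x} refl = ∈-map⁺ (vertex j) (∈-allFin x)

  part-unique : ∀ j → Unique (part j)
  part-unique j = Unique.map⁺ (λ { refl → refl }) (Unique.allFin⁺ (m j))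

  _≟ⱽ_ : DecidableEquality (Vertex m)
  _≟ⱽ_ = ≡-dec _≟_ _≟_

  open import Data.List.Membership.DecPropositional _≟ⱽ_ using (_∈?_)
  open import Data.List.Relation.Unary.Unique.DecPropositional _≟ⱽ_ using (unique?)

  record PathsIn (j : Fin t) (ps : List (List (Vertex m))) : Set where
    constructor pathsIn
    field
      segs : All (Segment (suc j)) ps
      uniq : Unique (concat ps)

  length≤length-concat : ∀ {j ps} → All (Segment (suc j)) ps → length ps ≤ length (concat ps)
  length≤length-concat [] = z≤n
  length≤length-concat {ps = [] ∷ _} (((ne , _) , _) ∷ _) = contradiction refl ne
  length≤length-concat {ps = (x ∷ p) ∷ ps} (_ ∷ segs) =
    s≤s (≤-trans (length≤length-concat segs) (≤-trans (m≤n+m _ (length p)) (≤-reflexive (sym (length-++ p)))))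

  length≤m : ∀ {j ps} → PathsIn j ps → length ps ≤ m j
  length≤m {j} {ps} (pathsIn segs uniq) =
    ≤-trans (length≤length-concat segs)
      (≤-trans (Unique-⊆⇒length≤ uniq (λ v∈ → ∈-part (All.lookup (AllP.concat⁺ (All.map proj₂ segs)) v∈)))
               (≤-reflexive (length-part j)))

  cut : ∀ {j ps} → All (Segment (suc j)) ps → length (concat ps) ≡ length ps ⊎
        ∃[ ps′ ] (All (Segment (suc j)) ps′ × concat ps′ ≡ concat ps × length ps′ ≡ suc (length ps))
  cut [] = inj₁ refl
  cut {ps = [] ∷ _} (((ne , _) , _) ∷ _) = contradiction refl ne
  cut {ps = (x ∷ y ∷ p) ∷ ps} (((_ , (_ ∷ link)) , (x∈ ∷ p∈)) ∷ segs) =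
    inj₂ ((x ∷ []) ∷ (y ∷ p) ∷ ps , (((λ ()) , [-]) , x∈ ∷ []) ∷ (((λ ()) , link) , p∈) ∷ segs , refl , refl)
  cut {ps = (x ∷ []) ∷ ps} (seg ∷ segs) with cut segs
  ... | inj₁ eq = inj₁ (cong suc eq)
  ... | inj₂ (ps′ , segs′ , eq , len) = inj₂ ((x ∷ []) ∷ ps′ , seg ∷ segs′ , cong (x ∷_) eq , cong suc len)

  -- A path with two or more vertices can lose its first vertex to a new path. If all are single
  -- vertices, fewer than `m j` vertices are covered, and an uncovered one becomes a new path.
  one-more : ∀ {j ps} → PathsIn j ps → length ps < m j →
             ∃[ ps′ ] (PathsIn j ps′ × length ps′ ≡ suc (length ps) × length (concat ps) ≤ length (concat ps′))
  one-more {j} {ps} (pathsIn segs uniq) lt with cut segs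
  ... | inj₂ (ps′ , segs′ , eq , len) =
    ps′ , pathsIn segs′ (subst Unique (sym eq) uniq) , len , ≤-reflexive (cong length (sym eq))
  ... | inj₁ singletons with any? (λ v → ¬? (v ∈? concat ps)) (part j)
  ...   | yes some with v , v∈ , v∉ ← find some with _ , _ , refl ← ∈-map⁻ (vertex j) v∈ =
    (v ∷ []) ∷ ps , pathsIn ((((λ ()) , [-]) , refl ∷ []) ∷ segs) (AllP.¬Any⇒All¬ _ v∉ ∷ uniq) , refl , n≤1+n _
  ...   | no none = contradiction (≤-trans lt m≤) (<-irrefl refl)
    where
    covers : ∀ {v} → v ∈ part j → v ∈ concat ps
    covers {v} v∈ = decidable-stable (v ∈? concat ps) λ v∉ → none (Any.map (λ { refl → v∉ }) v∈)

    m≤ : m j ≤ length ps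
    m≤ = ≤-trans (≤-reflexive (sym (length-part j)))
           (≤-trans (Unique-⊆⇒length≤ (part-unique j) covers) (≤-reflexive singletons))

  refine : ∀ d {j ps q} → PathsIn j ps → d + length ps ≡ q → q ≤ m j →
           ∃[ ps′ ] (PathsIn j ps′ × length ps′ ≡ q × length (concat ps) ≤ length (concat ps′))
  refine zero    {ps = ps} sys eq le = ps , sys , eq , ≤-refl
  refine (suc d) {ps = ps} sys refl le
    with ps₁ , sys₁ , len₁ , le₁ ← one-more sys (≤-trans (s≤s (m≤n+m (length ps) d)) le)
    with ps₂ , sys₂ , len₂ , le₂ ← refine d sys₁ (trans (cong (d +_) len₁) (+-suc d (length ps))) le =
    ps₂ , sys₂ , len₂ , ≤-trans le₁ le₂

  -- Improving a path subdigraph that covers too little of one part.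

  capacity : ℕ → Fin (suc t) → ℕ
  -- The closed walk of `F` already visits the apex `k` times, so this bound keeps the number of
  -- paths fixed under augmentation.
  capacity k zero    = k
  capacity k (suc j) = m j

  module _ {k L} (c : Code k L) (uniq : Unique L) where
    open Code c

    segments-pathsIn : ∀ j → PathsIn j (segments (suc j) items)
    segments-pathsIn j = pathsIn (segments-valid (suc j) valid)
      (subst Unique (sym (trans (concat-segments j valid) (cong (filter (part? j)) contents))) (Unique.filter⁺ (part? j) uniq))

    within-capacity : ∀ l → # l (labels items) ≤ capacity k l
    within-capacity zero    = ≤-reflexive visits
    within-capacity (suc j) = ≤-trans (≤-reflexive (sym (length-segments (suc j) items))) (length≤m (segments-pathsIn j))

    refine-segments : ∀ j q → # (suc j) (labels items) ≤ q → q ≤ m j →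
                      ∃[ ps ] (PathsIn j ps × length ps ≡ q × length (filter (part? j) L) ≤ length (concat ps))
    refine-segments j q le q≤m
      with ps , sys , len , more ← refine (q ∸ # (suc j) (labels items)) (segments-pathsIn j)
             (trans (cong (q ∸ # (suc j) (labels items) +_) (length-segments (suc j) items)) (m∸n+n≡m le)) q≤m =
      ps , sys , len , ≤-trans (≤-reflexive (cong length (sym (trans (concat-segments j valid) (cong (filter (part? j)) contents))))) more

  -- An arc of `T` joins all vertices of one part to all of another, so any disjoint paths in the
  -- parts, one for each visit, can be strung together along the walk.
  recode : ∀ {k Z} → ClosedWalk Z → # zero Z ≡ k →
           (S : ∀ j → ∃[ ps ] (PathsIn j ps × length ps ≡ # (suc j) Z)) →
           Σ[ F ∈ PathSubdigraph Q k ] (∀ j → filter (part? j) (covered F) ≡ concat (proj₁ (S j)))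
  recode {k} {Z} walk visits S =
    let its , labels≡ , valid , segs≡ = distribute Z family lengths segs
        filters : ∀ j → filter (part? j) (content its) ≡ concat (proj₁ (S j))
        filters j = trans (sym (concat-segments j valid)) (cong concat (segs≡ (suc j)))
        F , cov = decode
          record { items = its ; walk = subst ClosedWalk (sym labels≡) walk ; valid = valid
                 ; contents = refl ; visits = trans (cong (# zero) labels≡) visits }
          (Unique-fibres proj₁ (content its) λ j → subst Unique (sym (filters j)) (PathsIn.uniq (proj₁ (proj₂ (S j)))))
    in  F , λ j → trans (cong (filter (part? j)) cov) (filters j)
    where
    family : Fin (suc t) → List (List (Vertex m))
    family zero    = replicate (# zero Z) []
    family (suc j) = proj₁ (S j)

    lengths : ∀ l → length (family l) ≡ # l Z
    lengths zero    = length-replicate (# zero Z)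
    lengths (suc j) = proj₂ (proj₂ (S j))

    segs : ∀ l → All (Segment l) (family l)
    segs zero    = AllP.replicate⁺ (# zero Z) refl
    segs (suc j) = PathsIn.segs (proj₁ (proj₂ (S j)))

  code : ∀ {k} (F : PathSubdigraph Q k) → Code k (covered F)
  code record { paths = ps ; count = refl } = encode ps

  -- The enlarged walk visits each part at least as often as `F` does, and `H i` also at least as
  -- often as `G`. So `H i` can be filled with refined segments of `G` and every other part with
  -- refined segments of `F`: there is a gain in `H i` and no loss elsewhere.
  improve : Semicomplete T → ∀ {k} → 1 ≤ k → (F G : PathSubdigraph Q k) → ∀ i → coveredIn i F < coveredIn i G →
            Σ[ F′ ∈ PathSubdigraph Q k ] length (covered F) < length (covered F′)
  improve semi {k} 1≤k F G i lt
    with cF ← code F | cG ← code G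
    with Z , walk , X≤Z , Z≤M , Y≤Z ← enlarge (apex-semicomplete T semi) zero (apex→ T) (→apex T) (capacity k) (suc i)
           (# (suc i) (labels (Code.items cG))) (Code.walk cF) (Code.walk cG)
           (#-positive⇒∈ _ (≤-trans 1≤k (≤-reflexive (sym (Code.visits cF)))))
           (within-capacity cF (covered-unique F)) (within-capacity cG (covered-unique G)) (m≤m+n _ _) =
    let F′ , fibres = recode walk visits (λ j → proj₁ (S j) , proj₁ (proj₂ (S j)) , proj₁ (proj₂ (proj₂ (S j))))
        -- The extra entry `i` records the strict gain in `H i`, so comparing lengths gives a strict
        -- inequality.
        larger : ∀ j → # j (i ∷ map proj₁ (covered F)) ≤ # j (map proj₁ (covered F′))
        larger j = ≤-trans (proj₂ (proj₂ (proj₂ (S j))))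
          (≤-reflexive (sym (trans (#-map proj₁ j (covered F′)) (cong length (fibres j)))))
    in  F′ , (begin-strict
          length (covered F)                 ≡⟨ length-map proj₁ (covered F) ⟨
          length (map proj₁ (covered F))     <⟨ #-mono⇒length-mono (i ∷ map proj₁ (covered F)) (map proj₁ (covered F′)) larger ⟩
          length (map proj₁ (covered F′))    ≡⟨ length-map proj₁ (covered F′) ⟩
          length (covered F′)                ∎)
    where
    open ≤-Reasoning

    visits : # zero Z ≡ k
    visits = ≤-antisym (Z≤M zero) (≤-trans (≤-reflexive (sym (Code.visits cF))) (X≤Z zero))

    S : ∀ j → ∃[ ps ] (PathsIn j ps × length ps ≡ # (suc j) Z × # j (i ∷ map proj₁ (covered F)) ≤ length (concat ps))
    S j with i ≟ j
    ... | yes refl with ps , sys , len , more ← refine-segments cG (covered-unique G) i (# (suc i) Z) Y≤Z (Z≤M (suc i)) =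
      ps , sys , len , ≤-trans (s≤s (≤-reflexive (#-map proj₁ i (covered F)))) (≤-trans lt more)
    ... | no _ with ps , sys , len , more ← refine-segments cF (covered-unique F) j (# (suc j) Z) (X≤Z (suc j)) (Z≤M (suc j)) =
      ps , sys , len , ≤-trans (≤-reflexive (#-map proj₁ j (covered F))) more

  -- Finite enumeration of the path subdigraphs.

  allVertices : List (Vertex m)
  allVertices = concat (map part (allFin t))

  ∈-allVertices : ∀ v → v ∈ allVertices
  ∈-allVertices (i , x) = ∈-concat⁺′ (∈-part refl) (∈-map⁺ part (∈-allFin i))

  Admissible : ℕ → List (List (Vertex m)) → Set
  Admissible k ps = length ps ≡ k × All IsPath ps × Unique (concat ps)

  admissible? : ∀ k → Decidable (Admissible k)
  admissible? k ps = (length ps ≟ᴺᵃᵗ k) ×-dec (All.all? isPath? ps ×-dec unique? (concat ps))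

  candidates : ℕ → List (List (List (Vertex m)))
  candidates k = filter (admissible? k) (listsUpTo (listsUpTo allVertices (length allVertices)) k)

  -- A path repeats no vertex, so it is no longer than `allVertices` and occurs in the bounded
  -- enumeration.
  ∈-candidates : ∀ {k} (F : PathSubdigraph Q k) → map vertices (paths F) ∈ candidates k
  ∈-candidates {k} F = ∈-filter⁺ (admissible? k)
    (∈-listsUpTo (AllP.map⁺ (All.universal bounded (paths F))) (≤-reflexive len))
    (len , AllP.map⁺ (All.universal (λ p → nonempty p , linked p) (paths F)) , covered-unique F)
    where
    len : length (map vertices (paths F)) ≡ k
    len = trans (length-map vertices (paths F)) (count F)

    bounded : ∀ p → vertices {D = Q} p ∈ listsUpTo allVertices (length allVertices)
    bounded p = ∈-listsUpTo (All.universal ∈-allVertices (vertices p)) (Unique-⊆⇒length≤ (distinct p) (λ _ → ∈-allVertices _))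

theorem3p6 : (t : ℕ) → 2 ≤ t →
    (m : Fin t → ℕ) → (∀ i → NonZero (m i)) →
    (T : Digraph (Fin t)) (H : (i : Fin t) → Digraph (Fin (m i))) →
    Semicomplete T → Strong (T [ H ]) →
    (k : ℕ) → 1 ≤ k → k ≤ order m →
    (i : Fin t) →
    ∃[ nᵢₖ ] (((F : PathSubdigraph (T [ H ]) k) → IsMaximum F → coveredIn i F ≡ nᵢₖ) × ((F : PathSubdigraph (T [ H ]) k) → coveredIn i F ≤ nᵢₖ))
theorem3p6 t _ m _ T H semi _ k 1≤k _ i = n , (λ F F-max → ≤-antisym (upper F) (attained F F-max)) , upper
  where
  open Composition T H

  inPart : List (List (Vertex m)) → ℕ
  inPart ps = length (filter (part? i) (concat ps))

  n : ℕ
  -- The largest share of `H i` in any `k`-path subdigraph, which makes the upper bound immediate;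
  -- the default 0 lies below every share.
  n = max 0 (map inPart (candidates k))

  upper : (F : PathSubdigraph (T [ H ]) k) → coveredIn i F ≤ n
  upper F = All.lookup (xs≤max 0 (map inPart (candidates k))) (∈-map⁺ inPart (∈-candidates F))

  attained : (F : PathSubdigraph (T [ H ]) k) → IsMaximum F → n ≤ coveredIn i F
  attained F F-max = max≤v⁺ z≤n (AllP.map⁺ (All.tabulate bound))
    where
    bound : ∀ {ps} → ps ∈ candidates k → inPart ps ≤ coveredIn i F
    bound {ps} ps∈
      with _ , refl , paths , uniq ← ∈-filter⁻ (admissible? k) {xs = listsUpTo (listsUpTo allVertices (length allVertices)) k} ps∈
      with G , eq ← pathSubdigraph ps paths uniq =
      -- If the candidate `G` had a larger share of `H i` than `F`, `improve` would beat the maximum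
      -- `F`.
      ≤-trans (≤-reflexive (cong (length ∘ filter (part? i)) (sym eq))) (≮⇒≥ λ lt →
        let F′ , longer = improve semi 1≤k F G i lt in <-irrefl refl (<-≤-trans longer (F-max F′)))
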